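{- Let $n\geq 5$ be an integer and let $E(W_n)$ be the eccentricity matrix of the wheel graph $W_n$ on $n$ vertices. Then $$\det(E(W_n))=\begin{cases}2^{n-2}(1-n) & \text{if } n\not\equiv 1 \pmod 3,\\ 0 & \text{if } n\equiv 1 \pmod 3.\end{cases}$$
   Context: For a simple connected graph $G$ with vertices $v_1,\dots,v_n$, let $d(v_i,v_j)$ be the length of a shortest path between $v_i$ and $v_j$, and let $e(v_i)=\max\{d(v_i,v_j):1\le j\le n\}$ be the eccentricity of $v_i$. The eccentricity matrix $E(G)$ is the $n\times n$ real matrix with $(E(G))_{ij}=d(v_i,v_j)$ if $d(v_i,v_j)=\min\{e(v_i),e(v_j)\}$, and $(E(G))_{ij}=0$ otherwise. For $n\ge 4$, the wheel graph $W_n$ is the graph on $n$ vertices consisting of a cycle of length $n-1$ together with one further vertex (the hub) adjacent to every vertex of the cycle. The vertices are labelled so that $v_1$ is the hub and $v_2,\dots,v_n$ are the cycle vertices in cyclic order. -}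

module Defs where

open import Data.Empty using (⊥)
open import Data.Fin using (Fin; zero; suc; toℕ; punchIn)
open import Data.Fin.Properties as Fin using (any?)
open import Data.Integer using (ℤ; +_; 0ℤ; 1ℤ; -1ℤ; _*_; _^_)
open import Data.Integer.Properties using (+-0-commutativeMonoid)
open import Data.Nat as ℕ using (ℕ; zero; suc; _≤_; z≤n; s≤s; s≤s⁻¹; _⊔_; _⊓_)
open import Data.Nat.Properties using (1+n≢n; suc-injective)
open import Data.Product using (Σ; ∃; _×_; _,_; proj₁; uncurry)
open import Data.Sum using (_⊎_; inj₁; inj₂; swap)
open import Data.Unit using (⊤; tt)
open import Data.Vec as Vec using (Vec; []; _∷_)
open import Data.Vec.Functional as VF using (Vector)
open import Data.Vec.Relation.Unary.All using ([]; _∷_)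
open import Data.Vec.Relation.Unary.AllPairs using ([]; _∷_; allPairs?)
open import Data.Vec.Relation.Unary.Linked using (Linked; [-]; _∷_; linked?)
open import Data.Vec.Relation.Unary.Unique.Propositional using (Unique)
open import Function using (_∘_)
open import Level using (0ℓ)
open import Relation.Binary using (Rel; Symmetric; Irreflexive) renaming (Decidable to Decidable₂)
open import Relation.Binary.PropositionalEquality using (_≡_; refl; sym; trans)
open import Relation.Nullary using (Dec; yes; no; ¬_; ¬?; contradiction; does; _×-dec_; _⊎-dec_)
open import Relation.Nullary.Decidable using (map′)
open import Relation.Unary using (Pred; Decidable)
open import Data.Bool using (if_then_else_)
open import Algebra.Properties.CommutativeMonoid.Sum +-0-commutativeMonoid using (sum)

record SimpleGraph (n : ℕ) : Set₁ where
  field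
    Adj        : Rel (Fin n) 0ℓ
    adj?       : Decidable₂ Adj
    adj-sym    : Symmetric Adj
    adj-irrefl : Irreflexive _≡_ Adj

open SimpleGraph

module _ {n : ℕ} (G : SimpleGraph n) where

  -- A path of length k is its sequence of k + 1 distinct vertices.
  IsPath : Fin n → Fin n → {k : ℕ} → Vec (Fin n) (suc k) → Set
  IsPath u v p = Vec.head p ≡ u × Vec.last p ≡ v × Linked (Adj G) p × Unique p

  Path : Fin n → Fin n → ℕ → Set
  Path u v k = Σ (Vec (Fin n) (suc k)) (IsPath u v)

  Connected : Set
  Connected = ∀ u v → ∃ (Path u v)

  any-Vec? : ∀ {k} {P : Pred (Vec (Fin n) k) 0ℓ} → Decidable P → Dec (∃ P)
  any-Vec? {zero}  P? = map′ ([] ,_) (λ { ([] , p) → p }) (P? [])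
  any-Vec? {suc k} P? =
    map′ (λ { (x , xs , p) → x ∷ xs , p }) (λ { (x ∷ xs , p) → x , xs , p })
         (any? λ x → any-Vec? λ xs → P? (x ∷ xs))

  path? : ∀ u v → Decidable (Path u v)
  path? u v k = any-Vec? λ p →
    (Vec.head p Fin.≟ u) ×-dec (Vec.last p Fin.≟ v)
      ×-dec linked? (adj? G) p ×-dec allPairs? (λ x y → ¬? (x Fin.≟ y)) p

least : {P : Pred ℕ 0ℓ} → Decidable P → ∀ k → P k → ∃ λ m → P m × (∀ {j} → P j → m ≤ j)
least P? k p with P? 0
least P? k       p | yes p₀ = 0 , p₀ , λ _ → z≤n
least P? zero    p | no ¬p₀ = contradiction p ¬p₀
least P? (suc k) p | no ¬p₀ with least (P? ∘ suc) k p
... | m , pₘ , minimal = suc m , pₘ , λ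
  { {zero}  q → contradiction q ¬p₀
  ; {suc j} q → s≤s (minimal q) }

Matrix : ℕ → Set
Matrix n = Vector (Vector ℤ n) n

-- Laplace expansion along the first row; `punchIn j` enumerates, in increasing
-- order, the columns other than j.
det : ∀ {n} → Matrix n → ℤ
det {zero}  A = 1ℤ
det {suc n} A =
  sum λ j → -1ℤ ^ toℕ j * A zero j * det (λ i k → A (suc i) (punchIn j k))

module _ {n : ℕ} (G : SimpleGraph n) (connected : Connected G) where

  shortest : ∀ u v → ∃ λ k → Path G u v k × (∀ {j} → Path G u v j → k ≤ j)
  shortest u v = uncurry (least (path? G u v)) (connected u v)

  dist : Fin n → Fin n → ℕ
  dist u v = proj₁ (shortest u v)

  ecc : Fin n → ℕ
  ecc u = VF.foldr _⊔_ 0 (dist u)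

  -- The entries are natural numbers, so the matrix and its determinant are
  -- taken over ℤ rather than ℝ.
  eccentricityMatrix : Matrix n
  eccentricityMatrix u v =
    if does (dist u v ℕ.≟ ecc u ⊓ ecc v) then + dist u v else 0ℤ

-- `CyclicSuc i j`: j follows i in the cyclic order 0, 1, …, m - 1, 0.
CyclicSuc : ∀ {m} → Rel (Fin m) 0ℓ
CyclicSuc {m} i j = suc (toℕ i) ≡ toℕ j ⊎ (suc (toℕ i) ≡ m × toℕ j ≡ 0)

cyclicSuc? : ∀ {m} → Decidable₂ (CyclicSuc {m})
cyclicSuc? {m} i j =
  (suc (toℕ i) ℕ.≟ toℕ j) ⊎-dec ((suc (toℕ i) ℕ.≟ m) ×-dec (toℕ j ℕ.≟ 0))

cyclicSuc-irrefl : ∀ {m} → 3 ≤ m → (i : Fin m) → ¬ CyclicSuc i i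
cyclicSuc-irrefl {suc (suc m)} _ i (inj₁ i+1≡i) = 1+n≢n i+1≡i
cyclicSuc-irrefl {suc (suc m)} _ i (inj₂ (i+1≡m , i≡0))
  with trans (sym (suc-injective i+1≡m)) i≡0
... | ()
cyclicSuc-irrefl {suc zero} (s≤s ()) i _

cycle : (m : ℕ) → 3 ≤ m → SimpleGraph m
cycle m 3≤m = record
  { Adj        = λ i j → CyclicSuc i j ⊎ CyclicSuc j i
  ; adj?       = λ i j → cyclicSuc? i j ⊎-dec cyclicSuc? j i
  ; adj-sym    = swap
  ; adj-irrefl = λ { {i} refl (inj₁ s) → cyclicSuc-irrefl 3≤m i s
                   ; {i} refl (inj₂ s) → cyclicSuc-irrefl 3≤m i s }
  }

-- The cone over G adds a vertex, numbered zero, adjacent to all vertices of G.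
module _ {m : ℕ} (G : SimpleGraph m) where

  ConeAdj : Rel (Fin (suc m)) 0ℓ
  ConeAdj zero    zero    = ⊥
  ConeAdj zero    (suc _) = ⊤
  ConeAdj (suc _) zero    = ⊤
  ConeAdj (suc i) (suc j) = Adj G i j

  coneAdj? : Decidable₂ ConeAdj
  coneAdj? zero    zero    = no λ ()
  coneAdj? zero    (suc _) = yes tt
  coneAdj? (suc _) zero    = yes tt
  coneAdj? (suc i) (suc j) = adj? G i j

  coneAdj-sym : Symmetric ConeAdj
  coneAdj-sym {zero}  {suc _} tt = tt
  coneAdj-sym {suc _} {zero}  tt = tt
  coneAdj-sym {suc i} {suc j} a  = adj-sym G a

  coneAdj-irrefl : Irreflexive _≡_ ConeAdj
  coneAdj-irrefl {suc i} refl a = adj-irrefl G refl a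

  cone : SimpleGraph (suc m)
  cone = record
    { Adj = ConeAdj ; adj? = coneAdj?
    ; adj-sym = λ {u} {v} → coneAdj-sym {u} {v} ; adj-irrefl = coneAdj-irrefl }

  cone-connected : Connected cone
  cone-connected zero zero =
    0 , zero ∷ [] , refl , refl , [-] , [] ∷ []
  cone-connected zero (suc j) =
    1 , zero ∷ suc j ∷ [] , refl , refl , tt ∷ [-] , ((λ ()) ∷ []) ∷ [] ∷ []
  cone-connected (suc i) zero =
    1 , suc i ∷ zero ∷ [] , refl , refl , tt ∷ [-] , ((λ ()) ∷ []) ∷ [] ∷ []
  cone-connected (suc i) (suc j) with i Fin.≟ j
  ... | yes refl = 0 , suc i ∷ [] , refl , refl , [-] , [] ∷ []
  ... | no  i≢j  =
    2 , suc i ∷ zero ∷ suc j ∷ [] , refl , refl , tt ∷ tt ∷ [-] ,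
      ((λ ()) ∷ (i≢j ∘ Fin.suc-injective) ∷ []) ∷ ((λ ()) ∷ []) ∷ [] ∷ []

-- The wheel graph on n vertices: vertex 0 is the hub and vertices 1, …, n - 1
-- form the cycle, in cyclic order.
wheel : (n : ℕ) → 4 ≤ n → SimpleGraph n
wheel (suc m) 4≤n = cone (cycle m (s≤s⁻¹ 4≤n))

wheel-connected : (n : ℕ) → (4≤n : 4 ≤ n) → Connected (wheel n 4≤n)
wheel-connected (suc m) 4≤n = cone-connected (cycle m (s≤s⁻¹ 4≤n))

{-# OPTIONS --safe #-}

-- Write m = n - 1 = k + 2 and N = I + A(Cₘ), so that E = (0 𝟙ᵀ ; 𝟙 2(J - N)).
-- Subtracting twice the hub row from the others replaces 2(J - N) by -2N. Since
-- the columns of N sum to 3, adding the other rim rows and six times the hub row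
-- to the first rim row turns it into (m, 0, …, 0), and expanding along it leaves,
-- up to the factor m (-2)ᵏ⁺¹ and a sign, the determinant with first row 𝟙
-- followed by all rows of N but the first. All but the last of those are
-- eᵢ + eᵢ₊₁ + eᵢ₊₂; eliminating with them reduces the determinant to a 2 × 2
-- one, which is periodic in k with period 3.
module Submission where

open import Defs
open SimpleGraph
open import Data.Bool using (Bool; true; false; if_then_else_; _∨_; _∧_)
open import Data.Bool.Properties using (∧-zeroʳ)
open import Data.Fin as Fin using (Fin; zero; suc; toℕ; punchIn; inject₁; fromℕ)
import Data.Fin.Properties as Fin
open import Data.Integer using (ℤ; +_; -[1+_]; 0ℤ; 1ℤ; -1ℤ; _+_; _*_; _-_; -_; _^_)
open import Data.Integer.Properties
  using (+-*-semiring; +-identityˡ; +-identityʳ; *-identityˡ; *-assoc; *-comm;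
         *-zeroˡ; *-zeroʳ; ^-zeroˡ; -1*i≡-i)
open import Algebra.Properties.Semiring.Sum +-*-semiring
  using (sum; sum-cong-≗; ∑-distrib-+; *-distribˡ-sum; sum-replicate-zero; sum-init-last)
open import Data.Integer.Tactic.RingSolver using (solve-∀)
open import Data.Nat as ℕ
  using (ℕ; zero; suc; _≤_; _<_; z≤n; s≤s; s≤s⁻¹; _∸_; _%_; _⊔_; _⊓_; _≡ᵇ_)
open import Data.Nat.Properties as ℕ using (<⇒≤)
open import Data.Product using (∃; _×_; _,_; proj₁; proj₂)
open import Data.Unit using (tt)
open import Data.Vec using ([]; _∷_)
open import Data.Vec.Functional using (Vector; head; tail; foldr)
  renaming (_∷_ to infixr 5 _◂_)
open import Data.Vec.Relation.Unary.All using ([]; _∷_)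
open import Data.Vec.Relation.Unary.AllPairs using ([]; _∷_)
open import Data.Vec.Relation.Unary.Linked using ([-]; _∷_)
open import Function using (_∘_)
open import Relation.Binary.PropositionalEquality
  using (_≡_; _≢_; _≗_; refl; sym; trans; cong; cong₂; module ≡-Reasoning)
open import Relation.Nullary using (¬_; Dec; yes; no; does; contradiction)
open import Relation.Nullary.Decidable using (dec-true; dec-false)

open ≡-Reasoning

-- Determinants

infix 4 _≋_
_≋_ : ∀ {k n} → (A B : Vector (Vector ℤ n) k) → Set
A ≋ B = ∀ i j → A i j ≡ B i j

deleteColumn : ∀ {k n} → Vector (Vector ℤ (suc n)) k → Fin (suc n) → Vector (Vector ℤ n) k
deleteColumn R j i k = R i (punchIn j k)

sum-zero : ∀ {n} {f : Vector ℤ n} → (∀ i → f i ≡ 0ℤ) → sum f ≡ 0ℤ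
sum-zero {n} f≡0 = trans (sum-cong-≗ f≡0) (sum-replicate-zero n)

sum-linear : ∀ {n} c d (f g : Vector ℤ n) →
  sum (λ i → c * f i + d * g i) ≡ c * sum f + d * sum g
sum-linear c d f g = trans
  (∑-distrib-+ (λ i → c * f i) (λ i → d * g i))
  (sym (cong₂ _+_ (*-distribˡ-sum c f) (*-distribˡ-sum d g)))

det-cong : ∀ {n} {A B : Matrix n} → A ≋ B → det A ≡ det B
det-cong {zero}  A≋B = refl
det-cong {suc n} A≋B = sum-cong-≗ λ j →
  cong₂ _*_ (cong (-1ℤ ^ toℕ j *_) (A≋B zero j))
            (det-cong λ i k → A≋B (suc i) (punchIn j k))

◂-cong : ∀ {k n} {x y : Vector ℤ n} {A B : Vector (Vector ℤ n) k} →
  x ≗ y → A ≋ B → (x ◂ A) ≋ (y ◂ B)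
◂-cong x≗y A≋B zero    = x≗y
◂-cong x≗y A≋B (suc i) = A≋B i

det-linear : ∀ {n} (c d : ℤ) (x y : Vector ℤ (suc n)) (A : Vector (Vector ℤ (suc n)) n) →
  det ((λ j → c * x j + d * y j) ◂ A) ≡ c * det (x ◂ A) + d * det (y ◂ A)
det-linear c d x y A = begin
  sum (λ j → s j * (c * x j + d * y j) * m j)
    ≡⟨ sum-cong-≗ (λ j → distrib (s j) c (x j) d (y j) (m j)) ⟩
  sum (λ j → c * (s j * x j * m j) + d * (s j * y j * m j))
    ≡⟨ sum-linear c d (λ j → s j * x j * m j) (λ j → s j * y j * m j) ⟩
  c * det (x ◂ A) + d * det (y ◂ A) ∎
  where
  s : Vector ℤ _
  s j = -1ℤ ^ toℕ j
  m : Vector ℤ _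
  m j = det (deleteColumn A j)
  distrib : ∀ s c x d y m → s * (c * x + d * y) * m ≡ c * (s * x * m) + d * (s * y * m)
  distrib = solve-∀

laplace₂ : ∀ {n} (a b : Vector ℤ (suc (suc n))) → ((Fin n → Fin (suc (suc n))) → ℤ) → ℤ
laplace₂ a b g = sum λ j → -1ℤ ^ toℕ j * a j *
  sum λ k → -1ℤ ^ toℕ k * b (punchIn j k) * g (punchIn j ∘ punchIn k)

-- Splitting off the terms that use column 0 leaves the same kind of sum on the
-- remaining columns.
laplace₂-antisym : ∀ {n} (a b : Vector ℤ (suc (suc n))) {g} →
  (∀ {φ ψ} → φ ≗ ψ → g φ ≡ g ψ) → laplace₂ a b g + laplace₂ b a g ≡ 0ℤ
laplace₂-antisym {zero} a b {g} g-cong =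
  -- No column is left over, so both arguments of `g` are functions on `Fin 0`, which agree
  -- pointwise.
  cancel (a zero) (b zero) (a (suc zero)) (b (suc zero)) (g-cong λ ())
  where
  expanded : ∀ a₀ b₀ a₁ b₁ g →
    1ℤ * a₀ * (1ℤ * b₁ * g + 0ℤ) + (-1ℤ * 1ℤ * a₁ * (1ℤ * b₀ * g + 0ℤ) + 0ℤ) +
    (1ℤ * b₀ * (1ℤ * a₁ * g + 0ℤ) + (-1ℤ * 1ℤ * b₁ * (1ℤ * a₀ * g + 0ℤ) + 0ℤ)) ≡ 0ℤ
  expanded = solve-∀
  cancel : ∀ a₀ b₀ a₁ b₁ {g₀ g₁} → g₀ ≡ g₁ →
    1ℤ * a₀ * (1ℤ * b₁ * g₀ + 0ℤ) + (-1ℤ * 1ℤ * a₁ * (1ℤ * b₀ * g₁ + 0ℤ) + 0ℤ) +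
    (1ℤ * b₀ * (1ℤ * a₁ * g₀ + 0ℤ) + (-1ℤ * 1ℤ * b₁ * (1ℤ * a₀ * g₁ + 0ℤ) + 0ℤ)) ≡ 0ℤ
  cancel a₀ b₀ a₁ b₁ {g₀} refl = expanded a₀ b₀ a₁ b₁ g₀
laplace₂-antisym {suc n} a b {g} g-cong = begin
  laplace₂ a b g + laplace₂ b a g
    ≡⟨ cong₂ _+_ (split a b) (split b a) ⟩
  (a zero * σ b - b zero * σ a + laplace₂ (tail a) (tail b) g′) +
  (b zero * σ a - a zero * σ b + laplace₂ (tail b) (tail a) g′)
    ≡⟨ cancel (a zero * σ b) (b zero * σ a) _ _ ⟩
  laplace₂ (tail a) (tail b) g′ + laplace₂ (tail b) (tail a) g′
    ≡⟨ laplace₂-antisym (tail a) (tail b) (λ φ≗ψ → g-cong (◂-≗ φ≗ψ)) ⟩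
  0ℤ ∎
  where
  ◂-≗ : ∀ {φ ψ : Fin n → Fin (suc (suc n))} → φ ≗ ψ → (zero ◂ suc ∘ φ) ≗ (zero ◂ suc ∘ ψ)
  ◂-≗ φ≗ψ zero    = refl
  ◂-≗ φ≗ψ (suc l) = cong suc (φ≗ψ l)
  g′ : (Fin n → Fin (suc (suc n))) → ℤ
  g′ φ = g (zero ◂ suc ∘ φ)
  -- The terms in which the other row takes column 0; they cancel against those with the two rows
  -- exchanged.
  σ : Vector ℤ (suc (suc (suc n))) → ℤ
  σ x = sum λ k → -1ℤ ^ toℕ k * x (suc k) * g (suc ∘ punchIn k)
  cancel : ∀ x y p q → (x - y + p) + (y - x + q) ≡ p + q
  cancel = solve-∀
  split : ∀ x y → laplace₂ x y g ≡ x zero * σ y - y zero * σ x + laplace₂ (tail x) (tail y) g′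
  split x y = begin
    p + sum (λ j → -1ℤ * s j * x (suc j) * (1ℤ * y zero * G j + inner j))
      ≡⟨ cong (λ z → p + z) (sum-cong-≗ λ j → trans
           (cong (λ z → -1ℤ * s j * x (suc j) * (1ℤ * y zero * G j + z)) (inner≡ j))
           (expand (s j) (x (suc j)) (y zero) (G j) (S j))) ⟩
    p + sum (λ j → - y zero * (s j * x (suc j) * G j) + 1ℤ * (s j * x (suc j) * S j))
      ≡⟨ cong (λ z → p + z) (sum-linear (- y zero) 1ℤ
           (λ j → s j * x (suc j) * G j) (λ j → s j * x (suc j) * S j)) ⟩
    p + (- y zero * σ x + 1ℤ * q)
      ≡⟨ collect (x zero) (σ y) (y zero) (σ x) q ⟩
    x zero * σ y - y zero * σ x + q ∎
    where
    p q : ℤ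
    p = 1ℤ * x zero * σ y
    q = laplace₂ (tail x) (tail y) g′
    s : ∀ {m} → Vector ℤ m
    s j = -1ℤ ^ toℕ j
    G : Vector ℤ (suc (suc n))
    G j = g (suc ∘ punchIn j)
    inner S : Vector ℤ (suc (suc n))
    inner j = sum λ k →
      -1ℤ * s k * y (suc (punchIn j k)) * g (punchIn (suc j) ∘ punchIn (suc k))
    S j = sum λ k → s k * y (suc (punchIn j k)) * g′ (punchIn j ∘ punchIn k)
    assoc₃ : ∀ s y g → -1ℤ * s * y * g ≡ -1ℤ * (s * y * g)
    assoc₃ = solve-∀
    expand : ∀ s x y G S → -1ℤ * s * x * (1ℤ * y * G + -1ℤ * S) ≡ - y * (s * x * G) + 1ℤ * (s * x * S)
    expand = solve-∀
    collect : ∀ x p y q z → 1ℤ * x * p + (- y * q + 1ℤ * z) ≡ x * p - y * q + z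
    collect = solve-∀
    inner≡ : ∀ j → inner j ≡ -1ℤ * S j
    inner≡ j = trans
      (sum-cong-≗ λ k → trans
        (cong (-1ℤ * s k * y (suc (punchIn j k)) *_)
          (g-cong {punchIn (suc j) ∘ punchIn (suc k)} {zero ◂ suc ∘ punchIn j ∘ punchIn k}
            λ { zero → refl ; (suc l) → refl }))
        (assoc₃ (s k) _ _))
      (sym (*-distribˡ-sum {suc n} -1ℤ
        (λ k → s k * y (suc (punchIn j k)) * g′ (punchIn j ∘ punchIn k))))

-- Both determinants unfold to `laplace₂` with the same `g`, the minor of `R` on the remaining
-- columns.
det-swap : ∀ {n} (a b : Vector ℤ (suc (suc n))) (R : Vector (Vector ℤ (suc (suc n))) n) →
  det (a ◂ b ◂ R) ≡ - det (b ◂ a ◂ R)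
det-swap a b R = begin
  p           ≡⟨ move p q ⟩
  (p + q) - q ≡⟨ cong (_- q) (laplace₂-antisym a b (λ φ≗ψ → det-cong λ i k → cong (R i) (φ≗ψ k))) ⟩
  0ℤ - q      ≡⟨ +-identityˡ (- q) ⟩
  - q         ∎
  where
  p = det (a ◂ b ◂ R)
  q = det (b ◂ a ◂ R)
  move : ∀ p q → p ≡ (p + q) - q
  move = solve-∀

self-negative⇒0 : ∀ {x} → x ≡ - x → x ≡ 0ℤ
self-negative⇒0 {+ zero} _ = refl
self-negative⇒0 {+ suc _} ()
self-negative⇒0 { -[1+ _ ]} ()

det-head-cong : ∀ {n} {x y : Vector ℤ (suc n)} (A : Vector (Vector ℤ (suc n)) n) →
  x ≗ y → det (x ◂ A) ≡ det (y ◂ A)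
det-head-cong {x = x} {y} A x≗y =
  det-cong {A = x ◂ A} {B = y ◂ A} (◂-cong x≗y λ _ _ → refl)

expand-◂ : ∀ {k n} (A : Vector (Vector ℤ n) (suc k)) → A ≋ (head A ◂ tail A)
expand-◂ A zero    j = refl
expand-◂ A (suc i) j = refl

det-swap′ : ∀ {n} (a : Vector ℤ (suc (suc n))) (A : Vector (Vector ℤ (suc (suc n))) (suc n)) →
  det (a ◂ A) ≡ - det (head A ◂ a ◂ tail A)
det-swap′ a A = trans
  (det-cong {A = a ◂ A} {B = a ◂ head A ◂ tail A} (◂-cong (λ _ → refl) (expand-◂ A)))
  (det-swap a (head A) (tail A))

deleteColumn-◂ : ∀ {k n} (r : Vector ℤ (suc n)) (R : Vector (Vector ℤ (suc n)) k) j →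
  deleteColumn (r ◂ R) j ≋ (r ∘ punchIn j ◂ deleteColumn R j)
deleteColumn-◂ r R j zero    _ = refl
deleteColumn-◂ r R j (suc i) _ = refl

-- If the copy is adjacent, swapping the two equal rows negates the determinant. Otherwise a swap
-- moves the top row to second place, and every minor along the new first row repeats a row.
det-repeat : ∀ {n} (A : Vector (Vector ℤ (suc n)) n) i → det (A i ◂ A) ≡ 0ℤ
det-repeat {suc n} A zero    = self-negative⇒0 (trans (det-swap′ (head A) A) (cong -_ (sym
  (det-cong {A = head A ◂ A} {B = head A ◂ head A ◂ tail A} (◂-cong (λ _ → refl) (expand-◂ A))))))
det-repeat {suc n} A (suc i) = trans (det-swap′ (A (suc i)) A) (cong -_ (sum-zero λ j → trans
  (cong (-1ℤ ^ toℕ j * A zero j *_) (trans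
    (det-cong (deleteColumn-◂ (A (suc i)) (tail A) j))
    (det-repeat (deleteColumn (tail A) j) i)))
  (*-zeroʳ (-1ℤ ^ toℕ j * A zero j))))

det-combination : ∀ {k n} (c : Vector ℤ k) (A : Vector (Vector ℤ (suc n)) k)
  (B : Vector (Vector ℤ (suc n)) n) →
  det ((λ j → sum λ i → c i * A i j) ◂ B) ≡ sum λ i → c i * det (A i ◂ B)
det-combination {zero}  c A B = sum-zero λ j →
  trans (cong (_* det (deleteColumn B j)) (*-zeroʳ (-1ℤ ^ toℕ j))) (*-zeroˡ (det (deleteColumn B j)))
det-combination {suc k} c A B = begin
  det ((λ j → c zero * A zero j + rest j) ◂ B)
    ≡⟨ det-head-cong B (λ j → cong (λ z → c zero * A zero j + z) (sym (*-identityˡ (rest j)))) ⟩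
  det ((λ j → c zero * A zero j + 1ℤ * rest j) ◂ B)
    ≡⟨ det-linear (c zero) 1ℤ (A zero) rest B ⟩
  c zero * det (A zero ◂ B) + 1ℤ * det (rest ◂ B)
    ≡⟨ cong (λ z → c zero * det (A zero ◂ B) + z)
         (trans (*-identityˡ (det (rest ◂ B))) (det-combination (tail c) (tail A) B)) ⟩
  c zero * det (A zero ◂ B) + sum (λ i → c (suc i) * det (A (suc i) ◂ B)) ∎
  where
  rest : Vector ℤ _
  rest j = sum λ i → c (suc i) * A (suc i) j

-- By linearity the added part contributes a combination of determinants with a repeated row.
det-add-rows : ∀ {n} (c : Vector ℤ n) (x : Vector ℤ (suc n)) (A : Vector (Vector ℤ (suc n)) n) →
  det (x ◂ A) ≡ det ((λ j → x j + sum λ i → c i * A i j) ◂ A)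
det-add-rows c x A = sym (begin
  det ((λ j → x j + y j) ◂ A)
    ≡⟨ det-head-cong A (λ j → sym (cong₂ _+_ (*-identityˡ (x j)) (*-identityˡ (y j)))) ⟩
  det ((λ j → 1ℤ * x j + 1ℤ * y j) ◂ A)
    ≡⟨ det-linear 1ℤ 1ℤ x y A ⟩
  1ℤ * det (x ◂ A) + 1ℤ * det (y ◂ A)
    ≡⟨ cong (λ z → 1ℤ * det (x ◂ A) + 1ℤ * z) (trans (det-combination c A A)
         (sum-zero λ i → trans (cong (c i *_) (det-repeat A i)) (*-zeroʳ (c i)))) ⟩
  1ℤ * det (x ◂ A) + 0ℤ
    ≡⟨ trans (+-identityʳ _) (*-identityˡ _) ⟩
  det (x ◂ A) ∎)
  where
  y : Vector ℤ _
  y j = sum λ i → c i * A i j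

-- Once the first two rows are swapped, the second row is handled by linearity
-- and the others by induction on the minors along it.
det-shift : ∀ {n} (c : ℤ) (d : Vector ℤ n) (r : Vector ℤ (suc n))
  (A : Vector (Vector ℤ (suc n)) n) →
  det (r ◂ λ i j → c * A i j + d i * r j) ≡ c ^ n * det (r ◂ A)
det-shift {zero}  c d r A = sym (*-identityˡ _)
det-shift {suc n} c d r A = begin
  det (r ◂ B)
    ≡⟨ det-swap′ r B ⟩
  - det (head B ◂ r ◂ tail B)
    ≡⟨ cong -_ (det-linear c (d zero) (head A) r (r ◂ tail B)) ⟩
  - (c * det (head A ◂ r ◂ tail B) + d zero * det (r ◂ r ◂ tail B))
    ≡⟨ cong₂ (λ p q → - (c * p + d zero * q)) minors (det-repeat (r ◂ tail B) zero) ⟩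
  - (c * (c ^ n * det (head A ◂ r ◂ tail A)) + d zero * 0ℤ)
    ≡⟨ rearrange c (c ^ n) (det (head A ◂ r ◂ tail A)) (d zero) ⟩
  c * c ^ n * - det (head A ◂ r ◂ tail A)
    ≡⟨ cong (c * c ^ n *_) (det-swap′ r A) ⟨
  c * c ^ n * det (r ◂ A) ∎
  where
  B : Vector (Vector ℤ _) _
  B i j = c * A i j + d i * r j
  rearrange : ∀ c p x d → - (c * (p * x) + d * 0ℤ) ≡ c * p * - x
  rearrange = solve-∀
  commute : ∀ a p m → a * (p * m) ≡ p * (a * m)
  commute = solve-∀
  minors : det (head A ◂ r ◂ tail B) ≡ c ^ n * det (head A ◂ r ◂ tail A)
  minors = begin
    sum (λ j → u j * det (deleteColumn (r ◂ tail B) j))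
      ≡⟨ sum-cong-≗ (λ j → trans (cong (u j *_) (minor-shift j)) (commute (u j) (c ^ n) _)) ⟩
    sum (λ j → c ^ n * (u j * det (deleteColumn (r ◂ tail A) j)))
      ≡⟨ *-distribˡ-sum (c ^ n) (λ j → u j * det (deleteColumn (r ◂ tail A) j)) ⟨
    c ^ n * det (head A ◂ r ◂ tail A) ∎
    where
    u : Vector ℤ _
    u j = -1ℤ ^ toℕ j * A zero j
    minor-shift : ∀ j → det (deleteColumn (r ◂ tail B) j) ≡ c ^ n * det (deleteColumn (r ◂ tail A) j)
    minor-shift j = begin
      det (deleteColumn (r ◂ tail B) j)
        ≡⟨ det-cong (deleteColumn-◂ r (tail B) j) ⟩
      det (r ∘ punchIn j ◂ deleteColumn (tail B) j)
        ≡⟨ det-shift c (tail d) (r ∘ punchIn j) (deleteColumn (tail A) j) ⟩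
      c ^ n * det (r ∘ punchIn j ◂ deleteColumn (tail A) j)
        ≡⟨ cong (c ^ n *_) (det-cong (deleteColumn-◂ r (tail A) j)) ⟨
      c ^ n * det (deleteColumn (r ◂ tail A) j) ∎

-- The hypothesis concerns products so as to cover both vanishing entries of the first row and
-- vanishing minors.
det-leading-term : ∀ {n} (A : Matrix (suc n)) →
  (∀ j → A zero (suc j) * det (deleteColumn (tail A) (suc j)) ≡ 0ℤ) →
  det A ≡ A zero zero * det (deleteColumn (tail A) zero)
det-leading-term A vanish = trans
  (cong (λ z → 1ℤ * A zero zero * det (deleteColumn (tail A) zero) + z)
    (sum-zero λ j → trans (*-assoc (-1ℤ ^ suc (toℕ j)) _ _)
      (trans (cong (-1ℤ ^ suc (toℕ j) *_) (vanish j)) (*-zeroʳ (-1ℤ ^ suc (toℕ j))))))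
  (trans (+-identityʳ _) (cong (_* det (deleteColumn (tail A) zero)) (*-identityˡ (A zero zero))))

-- Proved by mutual recursion with `det-pivot`: a minor that omits a column other than 0 retains the
-- zero column.
det-zero-column : ∀ {n} (A : Matrix (suc n)) → (∀ i → A i zero ≡ 0ℤ) → det A ≡ 0ℤ

det-pivot : ∀ {n} (A : Matrix (suc n)) → (∀ i → A (suc i) zero ≡ 0ℤ) →
  det A ≡ A zero zero * det (deleteColumn (tail A) zero)
det-pivot {zero}  A column = det-leading-term A λ ()
det-pivot {suc n} A column = det-leading-term A λ j → trans
  (cong (A zero (suc j) *_) (det-zero-column (deleteColumn (tail A) (suc j)) column))
  (*-zeroʳ (A zero (suc j)))

det-zero-column A column = trans (det-pivot A (column ∘ suc))
  (cong (_* det (deleteColumn (tail A) zero)) (column zero))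

-- Bordered banded matrices

⟦_⟧ : Bool → ℤ
⟦ b ⟧ = if b then 1ℤ else 0ℤ

-- The index `c` may lie past the last column, giving the zero vector, and `δ (suc c) (suc j)`
-- reduces to `δ c j`, so shifting columns is definitional.
δ : ∀ {n} → ℕ → Vector ℤ n
δ c j = ⟦ toℕ j ≡ᵇ c ⟧

band : ∀ {n} → ℕ → Vector ℤ n
band i j = δ i j + δ (suc i) j + δ (suc (suc i)) j

-- One step of Gaussian elimination: column 0 of `x` is cleared with the pivot row `band 0` and
-- dropped.
reduce : ∀ {n} → Vector ℤ (suc n) → Vector ℤ n
reduce x j = x (suc j) - x zero * band 0 (suc j)

-- The 2 × 2 determinant of what remains of `a` and `b` after `k` pivots.
bracket : ∀ k (a b : Vector ℤ (suc (suc k))) → ℤ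
bracket zero    a b = a zero * b (suc zero) - a (suc zero) * b zero
bracket (suc k) a b = bracket k (reduce a) (reduce b)

reduce-cong : ∀ {n} {x y : Vector ℤ (suc n)} → x ≗ y → reduce x ≗ reduce y
reduce-cong x≗y j = cong₂ (λ p q → p - q * band 0 (suc j)) (x≗y (suc j)) (x≗y zero)

bracket-cong : ∀ k {a a′ b b′} → a ≗ a′ → b ≗ b′ → bracket k a b ≡ bracket k a′ b′
bracket-cong zero    a≗ b≗ =
  cong₂ _-_ (cong₂ _*_ (a≗ zero) (b≗ (suc zero))) (cong₂ _*_ (a≗ (suc zero)) (b≗ zero))
bracket-cong (suc k) a≗ b≗ = bracket-cong k (reduce-cong a≗) (reduce-cong b≗)

-- The first band row is swapped to the top, at the cost of a sign, and its leading 1 clears column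
-- 0. The minor has the same shape, one size smaller.
det-banded : ∀ k (a : Vector ℤ (suc (suc k))) (A : Vector (Vector ℤ (suc (suc k))) (suc k)) →
  (∀ i j → A (inject₁ i) j ≡ band (toℕ i) j) →
  det (a ◂ A) ≡ -1ℤ ^ k * bracket k a (A (fromℕ k))
det-banded zero a A _ = expanded (a zero) (a (suc zero)) (A zero zero) (A zero (suc zero))
  where
  expanded : ∀ a₀ a₁ b₀ b₁ →
    1ℤ * a₀ * (1ℤ * b₁ * 1ℤ + 0ℤ) + (-1ℤ * 1ℤ * a₁ * (1ℤ * b₀ * 1ℤ + 0ℤ) + 0ℤ) ≡
    1ℤ * (a₀ * b₁ - a₁ * b₀)
  expanded = solve-∀
det-banded (suc k) a A banded = begin
  det (a ◂ A)
    ≡⟨ det-swap′ a A ⟩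
  - det (head A ◂ C)
    ≡⟨ cong -_ (*-identityˡ (det (head A ◂ C))) ⟨
  - (1ℤ * det (head A ◂ C))
    ≡⟨ cong (λ z → - (z * det (head A ◂ C))) (^-zeroˡ (suc (suc k))) ⟨
  - (1ℤ ^ suc (suc k) * det (head A ◂ C))
    ≡⟨ cong -_ (det-shift 1ℤ (λ i → - C i zero) (head A) C) ⟨
  - det (head A ◂ B)
    ≡⟨ cong -_ (trans (det-pivot (head A ◂ B) column)
         (trans (cong (_* det (deleteColumn B zero)) (banded zero zero)) (*-identityˡ (det (deleteColumn B zero))))) ⟩
  - det (deleteColumn B zero)
    ≡⟨ cong -_ (det-cong reduced) ⟩
  - det (reduce a ◂ A′)
    ≡⟨ cong -_ (det-banded k (reduce a) A′ banded′) ⟩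
  - (-1ℤ ^ k * bracket k (reduce a) (A′ (fromℕ k)))
    ≡⟨ negate (-1ℤ ^ k) _ ⟩
  -1ℤ * -1ℤ ^ k * bracket k (reduce a) (A′ (fromℕ k)) ∎
  where
  C B : Vector (Vector ℤ _) _
  C = a ◂ tail A
  B i j = 1ℤ * C i j + - C i zero * A zero j
  A′ : Vector (Vector ℤ _) _
  A′ i = reduce (A (suc i))
  cancel : ∀ x → 1ℤ * x + - x * 1ℤ ≡ 0ℤ
  cancel = solve-∀
  negate : ∀ p x → - (p * x) ≡ -1ℤ * p * x
  negate = solve-∀
  column : ∀ i → B i zero ≡ 0ℤ
  column i = trans (cong (λ z → 1ℤ * C i zero + - C i zero * z) (banded zero zero)) (cancel (C i zero))
  to-reduce : ∀ (x : Vector ℤ _) j → 1ℤ * x (suc j) + - x zero * A zero (suc j) ≡ reduce x j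
  to-reduce x j = trans
    (cong (λ z → 1ℤ * x (suc j) + - x zero * z) (banded zero (suc j)))
    (shape (x (suc j)) (x zero) (band 0 (suc j)))
    where
    shape : ∀ p q t → 1ℤ * p + - q * t ≡ p - q * t
    shape = solve-∀
  reduced : deleteColumn B zero ≋ (reduce a ◂ A′)
  reduced zero    = to-reduce a
  reduced (suc i) = to-reduce (A (suc i))
  banded′ : ∀ i j → A′ (inject₁ i) j ≡ band (toℕ i) j
  -- `band (suc i)` is 0 in column 0, so reducing it only shifts it to `band i`.
  banded′ i j = trans
    (cong₂ (λ p q → p - q * band 0 (suc j)) (banded (suc i) (suc j)) (banded (suc i) zero))
    (+-identityʳ (band (toℕ i) j))

𝟙 : ∀ {n} → Vector ℤ n
𝟙 _ = 1ℤ

-- The two rows of I + A(C) that wrap around, for the cycle C on k + 2 vertices; row i + 1 in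
-- between is `band i`. For k = 0 coinciding indices count twice, which keeps the column sums at 3.
firstRow lastRow : ∀ k → Vector ℤ (suc (suc k))
firstRow k j = δ 0 j + δ 1 j + δ (suc k) j
lastRow  k j = δ 0 j + δ k j + δ (suc k) j

-- Three reductions restore 𝟙, via (0, 0, 1, ...) and (0, 1, 1, ...), and restore `δ 0`, via (-1,
-- -1, 0, ...) and (0, 1, 0, ...), while the two far entries of the last row move three places left.
-- Behind this, 1 + x + x² divides x³ - 1.
bracket-period : ∀ k →
  bracket (3 ℕ.+ k) 𝟙 (lastRow (3 ℕ.+ k)) ≡ bracket k 𝟙 (lastRow k)
bracket-period k = bracket-cong k ones last
  where
  ones : reduce (reduce (reduce {suc (suc (suc (suc k)))} 𝟙)) ≗ 𝟙
  ones zero          = refl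
  ones (suc zero)    = refl
  ones (suc (suc j)) = refl
  last : reduce (reduce (reduce (lastRow (3 ℕ.+ k)))) ≗ lastRow k
  last zero with 0 ≡ᵇ k
  ... | true  = refl
  ... | false = refl
  last (suc zero) with 1 ≡ᵇ k | 0 ≡ᵇ k
  ... | true  | true  = refl
  ... | true  | false = refl
  ... | false | true  = refl
  ... | false | false = refl
  last (suc (suc j)) with 2 ℕ.+ toℕ j ≡ᵇ k | 1 ℕ.+ toℕ j ≡ᵇ k
  ... | true  | true  = refl
  ... | true  | false = refl
  ... | false | true  = refl
  ... | false | false = refl

bracket-≢1 : ∀ k → k % 3 ≢ 1 → bracket k 𝟙 (lastRow k) ≡ -1ℤ
bracket-≢1 0 _   = refl
bracket-≢1 1 k≢1 = contradiction refl k≢1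
bracket-≢1 2 _   = refl
bracket-≢1 (suc (suc (suc k))) k≢1 = trans (bracket-period k) (bracket-≢1 k k≢1)

bracket-≡1 : ∀ k → k % 3 ≡ 1 → bracket k 𝟙 (lastRow k) ≡ 0ℤ
bracket-≡1 1 _ = refl
bracket-≡1 (suc (suc (suc k))) k≡1 = trans (bracket-period k) (bracket-≡1 k k≡1)

column-sum : ∀ k (j : Fin (suc (suc k))) →
  firstRow k j + (sum {k} (λ i → band (toℕ i) j) + lastRow k j) ≡ + 3
column-sum zero    zero       = refl
column-sum zero    (suc zero) = refl
column-sum (suc k) zero       = cong (λ z → 1ℤ + ((1ℤ + z) + 1ℤ)) (sum-zero {k} λ _ → refl)
-- Without column 0 the later bands shift by one, and `band 0` supplies the `δ 1` that the first row
-- loses and the `δ 0` that the last row loses.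
column-sum (suc k) (suc j)    = trans
  (regroup (δ 0 j) (δ 1 j) (δ k j) (δ (suc k) j) (sum {k} (λ i → band (toℕ i) j)))
  (column-sum k j)
  where
  regroup : ∀ a b c d s →
    (0ℤ + a + d) + (((0ℤ + a + b) + s) + (0ℤ + c + d)) ≡ (a + b + d) + (s + (a + c + d))
  regroup = solve-∀

sum-𝟙 : ∀ n → sum {n} 𝟙 ≡ + n
sum-𝟙 zero    = refl
sum-𝟙 (suc n) = cong (λ z → 1ℤ + z) (sum-𝟙 n)

[-2]^k*[-1]^k≡2^k : ∀ k → -[1+ 1 ] ^ k * -1ℤ ^ k ≡ (+ 2) ^ k
[-2]^k*[-1]^k≡2^k zero    = refl
[-2]^k*[-1]^k≡2^k (suc k) = trans (regroup (-[1+ 1 ] ^ k) (-1ℤ ^ k)) (cong (+ 2 *_) ([-2]^k*[-1]^k≡2^k k))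
  where
  regroup : ∀ p q → -[1+ 1 ] * p * (-1ℤ * q) ≡ + 2 * (p * q)
  regroup = solve-∀

module _ {k} (N : Matrix (suc (suc k)))
  (N-first : ∀ j → N zero j ≡ firstRow k j)
  (N-band  : ∀ i j → N (suc (inject₁ i)) j ≡ band (toℕ i) j)
  (N-last  : ∀ j → N (suc (fromℕ k)) j ≡ lastRow k j)
  where

  N-column-sum : ∀ j → N zero j + sum (λ i → N (suc i) j) ≡ + 3
  N-column-sum j = trans
    (cong₂ _+_ (N-first j) (trans (sum-init-last {k} (λ i → N (suc i) j))
      (cong₂ _+_ (sum-cong-≗ λ i → N-band i j) (N-last j))))
    (column-sum k j)

  det-bordered : (E : Matrix (suc (suc (suc k)))) →
    E zero zero ≡ 0ℤ → (∀ j → E zero (suc j) ≡ 1ℤ) → (∀ i → E (suc i) zero ≡ 1ℤ) →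
    (∀ i j → E (suc i) (suc j) ≡ + 2 - + 2 * N i j) →
    det E ≡ (+ 2) ^ suc k * (+ suc (suc k) * bracket k 𝟙 (lastRow k))
  det-bordered E E₀₀ E₀₁ E₁₀ E₁₁ = begin
    det E
      ≡⟨ det-cong entries ⟩
    -- Here `s` has the rim rows minus twice the hub row `h`.
    det (h ◂ λ i j → 1ℤ * s i j + + 2 * h j)
      ≡⟨ det-shift 1ℤ (λ _ → + 2) h s ⟩
    1ℤ ^ suc (suc k) * det (h ◂ s)
      ≡⟨ trans (cong (_* det (h ◂ s)) (^-zeroˡ (suc (suc k)))) (*-identityˡ _) ⟩
    det (h ◂ s)
      ≡⟨ det-swap′ h s ⟩
    - det (head s ◂ h ◂ tail s)
      ≡⟨ cong -_ (det-add-rows c (head s) (h ◂ tail s)) ⟩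
    - det (x ◂ h ◂ tail s)
      ≡⟨ cong -_ (det-leading-term (x ◂ h ◂ tail s) λ j →
           cong (_* det (deleteColumn (h ◂ tail s) (suc j))) (x-suc j)) ⟩
    - (x zero * det (deleteColumn (h ◂ tail s) zero))
      ≡⟨ cong₂ (λ p q → - (p * q)) x-zero (det-cong below) ⟩
    -- The zero multiples of 𝟙 give the rows the form required by `det-shift`, which then just pulls
    -- out a factor -2 from each.
    - (+ suc (suc k) * det (𝟙 ◂ λ i j → -[1+ 1 ] * N (suc i) j + 0ℤ * 𝟙 j))
      ≡⟨ cong (λ z → - (+ suc (suc k) * z)) (det-shift -[1+ 1 ] (λ _ → 0ℤ) 𝟙 (tail N)) ⟩
    - (+ suc (suc k) * (-[1+ 1 ] ^ suc k * det (𝟙 ◂ tail N)))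
      ≡⟨ cong (λ z → - (+ suc (suc k) * (-[1+ 1 ] ^ suc k * z)))
           (trans (det-banded k 𝟙 (tail N) N-band)
             (cong (-1ℤ ^ k *_) (bracket-cong k (λ _ → refl) N-last))) ⟩
    - (+ suc (suc k) * (-[1+ 1 ] ^ suc k * (-1ℤ ^ k * β)))
      -- The sign of the row swap raises the exponent of -1 from k to k + 1, matching that of -2.
      ≡⟨ regroup (+ suc (suc k)) (-[1+ 1 ] ^ suc k) (-1ℤ ^ k) β ⟩
    (-[1+ 1 ] ^ suc k * -1ℤ ^ suc k) * (+ suc (suc k) * β)
      ≡⟨ cong (_* (+ suc (suc k) * β)) ([-2]^k*[-1]^k≡2^k (suc k)) ⟩
    (+ 2) ^ suc k * (+ suc (suc k) * β) ∎
    where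
    β : ℤ
    β = bracket k 𝟙 (lastRow k)
    h : Vector ℤ (suc (suc (suc k)))
    h = 0ℤ ◂ 𝟙
    s : Vector (Vector ℤ (suc (suc (suc k)))) (suc (suc k))
    s i = 1ℤ ◂ λ j → -[1+ 1 ] * N i j
    -- The rim rows of `s` sum to -6 in each rim column, since the columns of `N` sum to 3; six hub
    -- rows cancel this.
    c : Vector ℤ (suc (suc k))
    c = + 6 ◂ 𝟙
    x : Vector ℤ (suc (suc (suc k)))
    x j = s zero j + sum (λ i → c i * (h ◂ tail s) i j)
    regroup : ∀ m p q b → - (m * (p * (q * b))) ≡ (p * (-1ℤ * q)) * (m * b)
    regroup = solve-∀
    doubled : ∀ t → + 2 - + 2 * t ≡ 1ℤ * (-[1+ 1 ] * t) + + 2 * 1ℤ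
    doubled = solve-∀
    entries : E ≋ (h ◂ λ i j → 1ℤ * s i j + + 2 * h j)
    entries zero    zero    = E₀₀
    entries zero    (suc j) = E₀₁ j
    entries (suc i) zero    = E₁₀ i
    entries (suc i) (suc j) = trans (E₁₁ i j) (doubled (N i j))
    x-zero : x zero ≡ + suc (suc k)
    x-zero = cong (λ z → 1ℤ + (0ℤ + z)) (sum-𝟙 (suc k))
    x-suc : ∀ j → x (suc j) ≡ 0ℤ
    x-suc j = begin
      -[1+ 1 ] * N zero j + (+ 6 + sum (λ i → 1ℤ * (-[1+ 1 ] * N (suc i) j)))
        ≡⟨ cong (λ z → -[1+ 1 ] * N zero j + (+ 6 + z))
             (trans (sum-cong-≗ λ i → *-identityˡ (-[1+ 1 ] * N (suc i) j))
               (sym (*-distribˡ-sum -[1+ 1 ] (λ i → N (suc i) j)))) ⟩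
      -[1+ 1 ] * N zero j + (+ 6 + -[1+ 1 ] * sum (λ i → N (suc i) j))
        ≡⟨ factor (N zero j) _ ⟩
      + 6 - + 2 * (N zero j + sum (λ i → N (suc i) j))
        ≡⟨ cong (λ z → + 6 - + 2 * z) (N-column-sum j) ⟩
      0ℤ ∎
      where
      factor : ∀ p q → -[1+ 1 ] * p + (+ 6 + -[1+ 1 ] * q) ≡ + 6 - + 2 * (p + q)
      factor = solve-∀
    below : deleteColumn (h ◂ tail s) zero ≋ (𝟙 ◂ λ i j → -[1+ 1 ] * N (suc i) j + 0ℤ * 𝟙 j)
    below zero    j = refl
    below (suc i) j = sym (+-identityʳ _)

-- Distances in cones and wheels

maximum-≤ : ∀ {n} (f : Vector ℕ n) {k} → (∀ i → f i ≤ k) → foldr _⊔_ 0 f ≤ k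
maximum-≤ {zero}  f f≤k = z≤n
maximum-≤ {suc n} f f≤k = ℕ.⊔-lub (f≤k zero) (maximum-≤ (f ∘ suc) (f≤k ∘ suc))

≤-maximum : ∀ {n} (f : Vector ℕ n) i → f i ≤ foldr _⊔_ 0 f
≤-maximum f zero    = ℕ.m≤m⊔n (f zero) _
≤-maximum f (suc i) = ℕ.≤-trans (≤-maximum (f ∘ suc) i) (ℕ.m≤n⊔m (f zero) _)

maximum≡ : ∀ {n} (f : Vector ℕ n) {k} i → (∀ j → f j ≤ k) → f i ≡ k → foldr _⊔_ 0 f ≡ k
maximum≡ f i f≤k refl = ℕ.≤-antisym (maximum-≤ f f≤k) (≤-maximum f i)

module _ {n} (G : SimpleGraph n) (connected : Connected G) where

  dist-≤ : ∀ u v {k} → Path G u v k → dist G connected u v ≤ k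
  dist-≤ u v = proj₂ (proj₂ (shortest G connected u v))

  dist-path : ∀ u v → Path G u v (dist G connected u v)
  dist-path u v = proj₁ (proj₂ (shortest G connected u v))

  path₀⇒≡ : ∀ {u v} → Path G u v 0 → u ≡ v
  path₀⇒≡ (_ ∷ [] , refl , refl , _) = refl

  path₁⇒adj : ∀ {u v} → Path G u v 1 → Adj G u v
  path₁⇒adj (_ ∷ _ ∷ [] , refl , refl , u~v ∷ _ , _) = u~v

  dist-self : ∀ u → dist G connected u u ≡ 0
  dist-self u = ℕ.n≤0⇒n≡0 (dist-≤ u u (u ∷ [] , refl , refl , [-] , [] ∷ []))

  dist-positive : ∀ u v → u ≢ v → 1 ≤ dist G connected u v
  dist-positive u v u≢v with dist G connected u v | dist-path u v
  ... | zero  | p = contradiction (path₀⇒≡ p) u≢v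
  ... | suc _ | _ = s≤s z≤n

  dist-adj : ∀ u v → Adj G u v → dist G connected u v ≡ 1
  dist-adj u v u~v = ℕ.≤-antisym
    (dist-≤ u v (u ∷ v ∷ [] , refl , refl , u~v ∷ [-] , (u≢v ∷ []) ∷ [] ∷ []))
    (dist-positive u v u≢v)
    where
    u≢v : u ≢ v
    u≢v u≡v = adj-irrefl G u≡v u~v

  dist-nonadj : ∀ u v → u ≢ v → ¬ Adj G u v → 2 ≤ dist G connected u v
  dist-nonadj u v u≢v u≁v with dist G connected u v | dist-path u v
  ... | zero        | p = contradiction (path₀⇒≡ p) u≢v
  ... | suc zero    | p = contradiction (path₁⇒adj p) u≁v
  ... | suc (suc _) | _ = s≤s (s≤s z≤n)

-- The matrix I + A(G), whose rows are the indicators of closed neighbourhoods.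
closedAdjacency : ∀ {m} → SimpleGraph m → Matrix m
closedAdjacency G i j = ⟦ does (i Fin.≟ j) ∨ does (adj? G i j) ⟧

-- Allows non-adjacency to be established by evaluating a matrix entry.
closedAdjacency≡0 : ∀ {m} (G : SimpleGraph m) {i j} →
  closedAdjacency G i j ≡ 0ℤ → i ≢ j × ¬ Adj G i j
closedAdjacency≡0 G {i} {j} eq with i Fin.≟ j | adj? G i j
closedAdjacency≡0 G () | yes _   | _
closedAdjacency≡0 G () | no _    | yes _
closedAdjacency≡0 G eq | no i≢j | no i≁j = i≢j , i≁j

module _ {m} (G : SimpleGraph (suc m)) (connected : Connected (cone G))
  (far : ∀ i → ∃ λ j → i ≢ j × ¬ Adj G i j) where

  private
    d : Fin (suc (suc m)) → Fin (suc (suc m)) → ℕ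
    d = dist (cone G) connected

    e : Fin (suc (suc m)) → ℕ
    e = ecc (cone G) connected

  hub-rim : ∀ j → d zero (suc j) ≡ 1
  hub-rim j = dist-adj (cone G) connected zero (suc j) tt

  rim-hub : ∀ i → d (suc i) zero ≡ 1
  rim-hub i = dist-adj (cone G) connected (suc i) zero tt

  hub-hub : d zero zero ≡ 0
  hub-hub = dist-self (cone G) connected zero

  rim-self : ∀ i → d (suc i) (suc i) ≡ 0
  rim-self i = dist-self (cone G) connected (suc i)

  rim-adj : ∀ i j → Adj G i j → d (suc i) (suc j) ≡ 1
  rim-adj i j = dist-adj (cone G) connected (suc i) (suc j)

  rim-≤2 : ∀ i j → d (suc i) (suc j) ≤ 2
  rim-≤2 i j with i Fin.≟ j
  ... | yes refl = ℕ.≤-trans (ℕ.≤-reflexive (rim-self i)) z≤n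
  ... | no i≢j = dist-≤ (cone G) connected (suc i) (suc j)
    (suc i ∷ zero ∷ suc j ∷ [] , refl , refl , tt ∷ tt ∷ [-] ,
      ((λ ()) ∷ (i≢j ∘ Fin.suc-injective) ∷ []) ∷ ((λ ()) ∷ []) ∷ [] ∷ [])

  rim-nonadj : ∀ i j → i ≢ j → ¬ Adj G i j → d (suc i) (suc j) ≡ 2
  rim-nonadj i j i≢j i≁j = ℕ.≤-antisym (rim-≤2 i j)
    (dist-nonadj (cone G) connected (suc i) (suc j) (i≢j ∘ Fin.suc-injective) i≁j)

  ecc-hub : e zero ≡ 1
  ecc-hub = maximum≡ (d zero) (suc zero) bound (hub-rim zero)
    where
    bound : ∀ j → d zero j ≤ 1
    bound zero    = ℕ.≤-trans (ℕ.≤-reflexive hub-hub) z≤n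
    bound (suc j) = ℕ.≤-reflexive (hub-rim j)

  -- Paths through the hub bound all distances by 2, and the vertex supplied by `far` attains the
  -- bound.
  ecc-rim : ∀ i → e (suc i) ≡ 2
  ecc-rim i =
    let j , i≢j , i≁j = far i
    in maximum≡ (d (suc i)) (suc j) bound (rim-nonadj i j i≢j i≁j)
    where
    bound : ∀ v → d (suc i) v ≤ 2
    bound zero    = ℕ.≤-trans (ℕ.≤-reflexive (rim-hub i)) (s≤s z≤n)
    bound (suc v) = rim-≤2 i v

  -- Replaces distances and eccentricities by numerals, at which the `if` computes.
  entry : ∀ u v {a b c} → d u v ≡ a → e u ≡ b → e v ≡ c →
    eccentricityMatrix (cone G) connected u v ≡
    (if a ≡ᵇ (b ⊓ c) then + a else 0ℤ)
  entry _ _ refl refl refl = refl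

  hub-hub-entry : eccentricityMatrix (cone G) connected zero zero ≡ 0ℤ
  hub-hub-entry = entry zero zero hub-hub ecc-hub ecc-hub

  hub-rim-entry : ∀ j → eccentricityMatrix (cone G) connected zero (suc j) ≡ 1ℤ
  hub-rim-entry j = entry zero (suc j) (hub-rim j) ecc-hub (ecc-rim j)

  rim-hub-entry : ∀ i → eccentricityMatrix (cone G) connected (suc i) zero ≡ 1ℤ
  rim-hub-entry i = entry (suc i) zero (rim-hub i) (ecc-rim i) ecc-hub

  -- Rim eccentricities are 2, so exactly the distances equal to 2 survive, at the zeros of I +
  -- A(G).
  rim-rim-entry : ∀ i j →
    eccentricityMatrix (cone G) connected (suc i) (suc j) ≡ + 2 - + 2 * closedAdjacency G i j
  rim-rim-entry i j = by-cases (i Fin.≟ j) (adj? G i j)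
    where
    by-cases : (i≟j : Dec (i ≡ j)) (i~?j : Dec (Adj G i j)) →
      eccentricityMatrix (cone G) connected (suc i) (suc j) ≡
        + 2 - + 2 * ⟦ does i≟j ∨ does i~?j ⟧
    by-cases (yes refl) _         = entry (suc i) (suc i) (rim-self i) (ecc-rim i) (ecc-rim i)
    by-cases (no _)     (yes i~j) = entry (suc i) (suc j) (rim-adj i j i~j) (ecc-rim i) (ecc-rim j)
    by-cases (no i≢j)   (no i≁j)  = entry (suc i) (suc j) (rim-nonadj i j i≢j i≁j) (ecc-rim i) (ecc-rim j)

-- The graph is a variable H rather than cone G: at a concrete wheel, conversion
-- checking then compares H with a cone instead of unfolding two determinants.
det-cone : ∀ {k} (G : SimpleGraph (suc (suc k))) {H} (connected : Connected H) → H ≡ cone G →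
  (∀ i → ∃ λ j → i ≢ j × ¬ Adj G i j) →
  (∀ j → closedAdjacency G zero j ≡ firstRow k j) →
  (∀ i j → closedAdjacency G (suc (inject₁ i)) j ≡ band (toℕ i) j) →
  (∀ j → closedAdjacency G (suc (fromℕ k)) j ≡ lastRow k j) →
  let E = eccentricityMatrix H connected in
  (k % 3 ≢ 1 → det E ≡ (+ 2) ^ suc k * (1ℤ - + suc (suc (suc k)))) × (k % 3 ≡ 1 → det E ≡ 0ℤ)
det-cone {k} G connected refl far first middle last =
  -- The product of k + 2 and -1 is 1 - n definitionally, where n = k + 3.
  (λ k≢1 → trans formula (cong ((+ 2) ^ suc k *_)
    (trans (cong (+ suc (suc k) *_) (bracket-≢1 k k≢1))
      (trans (*-comm (+ suc (suc k)) -1ℤ) (-1*i≡-i (+ suc (suc k))))))) ,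
  (λ k≡1 → trans formula (trans (cong ((+ 2) ^ suc k *_)
    (trans (cong (+ suc (suc k) *_) (bracket-≡1 k k≡1)) (*-zeroʳ (+ suc (suc k)))))
    (*-zeroʳ ((+ 2) ^ suc k))))
  where
  formula = det-bordered (closedAdjacency G) first middle last
    (eccentricityMatrix (cone G) connected)
    (hub-hub-entry G connected far) (hub-rim-entry G connected far)
    (rim-hub-entry G connected far) (rim-rim-entry G connected far)

-- Closed neighbourhoods in the cycle

does-≟ : ∀ {m} (i j : Fin m) → does (i Fin.≟ j) ≡ (toℕ i ≡ᵇ toℕ j)
does-≟ zero    zero    = refl
does-≟ zero    (suc j) = refl
does-≟ (suc i) zero    = refl
does-≟ (suc i) (suc j) = does-≟ i j

-- m is the length of the cycle on which i and j lie.
closedCyclic : (m i j : ℕ) → Bool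
closedCyclic m i j = (i ≡ᵇ j) ∨
  (((suc i ≡ᵇ j) ∨ ((suc i ≡ᵇ m) ∧ (j ≡ᵇ 0))) ∨ ((suc j ≡ᵇ i) ∨ ((suc j ≡ᵇ m) ∧ (i ≡ᵇ 0))))

module _ (p : ℕ) (3≤m : 3 ≤ 4 ℕ.+ p) where

  private
    k m : ℕ
    k = 2 ℕ.+ p
    m = 4 ℕ.+ p

    N : Matrix m
    N = closedAdjacency (cycle m 3≤m)

  -- Only the equality test on `Fin` needs rewriting; the adjacency test of the cycle already
  -- reduces to comparisons in ℕ.
  N≡ : ∀ i j → N i j ≡ ⟦ closedCyclic m (toℕ i) (toℕ j) ⟧
  N≡ i j = cong (λ b → ⟦ b ∨ does (adj? (cycle m 3≤m) i j) ⟧) (does-≟ i j)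

  far : ∀ i → ∃ λ j → i ≢ j × ¬ Adj (cycle m 3≤m) i j
  far i = proj₁ (witness i) ,
    closedAdjacency≡0 (cycle m 3≤m) (trans (N≡ i _) (proj₂ (witness i)))
    where
    witness : ∀ i → ∃ λ j → ⟦ closedCyclic m (toℕ i) (toℕ j) ⟧ ≡ 0ℤ
    -- Vertex 3 exists because the cycle has at least four vertices. From vertex 3 on, vertex 1
    -- serves, its only neighbours being 0 and 2.
    witness zero                = suc (suc zero) , refl
    witness (suc zero)          = suc (suc (suc zero)) , cong ⟦_⟧ (∧-zeroʳ (0 ≡ᵇ p))
    witness (suc (suc zero))    = zero , refl
    witness (suc (suc (suc i))) = suc zero , cong (λ b → ⟦ b ∨ false ⟧) (∧-zeroʳ (toℕ i ≡ᵇ p))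

  -- Row `suc i` is not the first and, as `i ≢ k`, not the last, so both wrap-around tests fail. The
  -- remaining tests are invariant under shifting `i` and `j` together.
  cyclic-band : ∀ i j → i ≢ k →
    ⟦ closedCyclic m (suc i) j ⟧ ≡ ⟦ j ≡ᵇ i ⟧ + ⟦ j ≡ᵇ suc i ⟧ + ⟦ j ≡ᵇ suc (suc i) ⟧
  cyclic-band i j i≢k
    rewrite dec-false (i ℕ.≟ k) i≢k | ∧-zeroʳ (suc j ≡ᵇ m) = table i j
    where
    table : ∀ i j → ⟦ (suc i ≡ᵇ j) ∨ (((suc (suc i) ≡ᵇ j) ∨ false) ∨ ((j ≡ᵇ i) ∨ false)) ⟧ ≡
      ⟦ j ≡ᵇ i ⟧ + ⟦ j ≡ᵇ suc i ⟧ + ⟦ j ≡ᵇ suc (suc i) ⟧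
    table zero    zero                = refl
    table zero    (suc zero)          = refl
    table zero    (suc (suc zero))    = refl
    table zero    (suc (suc (suc _))) = refl
    table (suc i) zero                = refl
    table (suc i) (suc j)             = table i j

  -- Wrapping around yields the entry in column 0; `j < m` excludes a successor in the nonexistent
  -- column `m`.
  cyclic-last : ∀ j → j < m →
    ⟦ closedCyclic m (suc k) j ⟧ ≡ ⟦ j ≡ᵇ 0 ⟧ + ⟦ j ≡ᵇ k ⟧ + ⟦ j ≡ᵇ suc k ⟧
  cyclic-last zero    j<m rewrite dec-true (p ℕ.≟ p) refl = refl
  cyclic-last (suc j) j<m
    rewrite dec-false (suc k ℕ.≟ j) (ℕ.>⇒≢ (s≤s⁻¹ j<m))
          | ∧-zeroʳ (k ≡ᵇ k) | ∧-zeroʳ (suc (suc j) ≡ᵇ m)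
    = table k j
    where
    table : ∀ k j → ⟦ (k ≡ᵇ j) ∨ ((suc j ≡ᵇ k) ∨ false) ⟧ ≡ 0ℤ + ⟦ suc j ≡ᵇ k ⟧ + ⟦ j ≡ᵇ k ⟧
    table zero          zero    = refl
    table zero          (suc j) = refl
    table (suc zero)    zero    = refl
    table (suc (suc k)) zero    = refl
    table (suc k)       (suc j) = table k j

  N-first : ∀ j → N zero j ≡ firstRow k j
  N-first j = trans (N≡ zero j) (table j)
    where
    table : ∀ j → ⟦ closedCyclic m 0 (toℕ j) ⟧ ≡ firstRow k j
    table zero          = refl
    table (suc zero)    = refl
    table (suc (suc j)) with toℕ j ≡ᵇ suc p
    ... | true  = refl
    ... | false = refl

  N-band : ∀ i j → N (suc (inject₁ i)) j ≡ band (toℕ i) j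
  N-band i j = trans (N≡ (suc (inject₁ i)) j)
    (trans (cong (λ x → ⟦ closedCyclic m (suc x) (toℕ j) ⟧) (Fin.toℕ-inject₁ i))
      (cyclic-band (toℕ i) (toℕ j) (ℕ.<⇒≢ (Fin.toℕ<n i))))

  N-last : ∀ j → N (suc (fromℕ k)) j ≡ lastRow k j
  N-last j = trans (N≡ (suc (fromℕ k)) j)
    (trans (cong (λ x → ⟦ closedCyclic m (suc x) (toℕ j) ⟧) (Fin.toℕ-fromℕ k))
      (cyclic-last (toℕ j) (Fin.toℕ<n j)))

theorem3p4 : (n : ℕ) (5≤n : 5 ≤ n) →
    let E = eccentricityMatrix (wheel n (<⇒≤ 5≤n)) (wheel-connected n (<⇒≤ 5≤n)) in
    (n % 3 ≢ 1 → det E ≡ (+ 2) ^ (n ∸ 2) * (1ℤ - + n)) × (n % 3 ≡ 1 → det E ≡ 0ℤ)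
theorem3p4 1 (s≤s ())
theorem3p4 2 (s≤s (s≤s ()))
theorem3p4 3 (s≤s (s≤s (s≤s ())))
theorem3p4 4 (s≤s (s≤s (s≤s (s≤s ()))))
theorem3p4 n@(suc (suc (suc (suc (suc p))))) 5≤n =
  -- Here k = 2 + p = n - 3, so `n % 3` reduces to `k % 3` and `n ∸ 2` to `suc k`.
  det-cone (cycle _ 3≤m) {wheel n (<⇒≤ 5≤n)} (wheel-connected n (<⇒≤ 5≤n)) refl
    (far p 3≤m) (N-first p 3≤m) (N-band p 3≤m) (N-last p 3≤m)
  where
  3≤m = s≤s⁻¹ (<⇒≤ 5≤n)
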